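{- Let $a(n) = M_n(1)$ for $n \ge 0$, where the polynomials $M_n(x)$ are defined by $M_0(x) = 1$, $M_1(x) = x$, and $M_{n+1}(x) = x\,M_n(x) - n^2\,M_{n-1}(x)$ for all $n \ge 1$. Then $$a(n) - a(n-1) + (n-1)^2\,a(n-2) = 0 \qquad \text{for all integers } n \ge 2.$$
   Context: The polynomials $M_n(x)$ (called Meixner polynomials here) are defined exactly by the three-term recurrence in the claim; the sequence $a(n) = M_n(1)$ is OEIS A214615, beginning $1, 1, 0, -4, -4, 60, 160, \ldots$. -}

module Defs where

open import Data.Nat.Base using (ℕ; zero; suc)
open import Data.Integer.Base using (ℤ; +_; _+_; -_; _*_; _^_; 0ℤ; 1ℤ)
open import Data.List.Base using (List; []; _∷_; [_]; map)
open import Relation.Binary.PropositionalEquality using (_≡_; refl)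

infixl 6 _+ₚ_ _-ₚ_
infixl 7 _*ₚ_

-- ℤ[x], as coefficient lists with the constant term first.  Trailing zeros
-- are allowed, so a polynomial has more than one representation.
Poly : Set
Poly = List ℤ

const : ℤ → Poly
const c = [ c ]

X : Poly
X = 0ℤ ∷ 1ℤ ∷ []

_+ₚ_ : Poly → Poly → Poly
[]      +ₚ q       = q
(a ∷ p) +ₚ []      = a ∷ p
(a ∷ p) +ₚ (b ∷ q) = (a + b) ∷ (p +ₚ q)

-ₚ_ : Poly → Poly
-ₚ p = map -_ p

_-ₚ_ : Poly → Poly → Poly
p -ₚ q = p +ₚ (-ₚ q)

_*ₚ_ : Poly → Poly → Poly
[]      *ₚ q = []
(a ∷ p) *ₚ q = map (a *_) q +ₚ (0ℤ ∷ (p *ₚ q))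

eval : Poly → ℤ → ℤ
eval []      x = 0ℤ
eval (c ∷ p) x = c + x * eval p x

-- The recurrence M_{k+1} = x M_k - k² M_{k-1} for k ≥ 1, with k = suc n.
M : ℕ → Poly
M zero          = const 1ℤ
M (suc zero)    = X
M (suc (suc n)) = X *ₚ M (suc n) -ₚ const ((+ suc n) ^ 2) *ₚ M n

a : ℕ → ℤ
a n = eval (M n) 1ℤ

-- The initial terms agree with OEIS A214615.
_ : map a (0 ∷ 1 ∷ 2 ∷ 3 ∷ 4 ∷ 5 ∷ 6 ∷ [])
    ≡ + 1 ∷ + 1 ∷ + 0 ∷ - (+ 4) ∷ - (+ 4) ∷ + 60 ∷ + 160 ∷ []
_ = refl

{-# OPTIONS --safe #-}
-- Evaluation at a point is a ring homomorphism ℤ[x] → ℤ, so the polynomial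
-- recurrence specialises at x = 1.
module Submission where

open import Defs
open import Data.Nat.Base using (ℕ; suc; _≤_; _∸_; s≤s)
open import Data.Integer.Base using (ℤ; +_; _+_; _-_; -_; _*_; _^_; 0ℤ; 1ℤ)
open import Data.Integer.Properties using (+-identityˡ; +-identityʳ; *-identityˡ; *-zeroʳ)
open import Data.Integer.Tactic.RingSolver using (solve-∀)
open import Data.List.Base using ([]; _∷_; map)
open import Relation.Binary.PropositionalEquality
  using (_≡_; refl; sym; trans; cong; cong₂; module ≡-Reasoning)

open ≡-Reasoning

-- At the point 1 the factor `X` takes the value 1, so the recurrence defining `M` becomes a
-- recurrence for `a`, and the claim is that identity with all terms on one side. The transfer rests
-- on `eval-+ₚ` and `eval-*ₚ`, both by induction along the Horner form `c + x * eval p x`.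

eval-+ₚ : ∀ p q x → eval (p +ₚ q) x ≡ eval p x + eval q x
eval-+ₚ []      q       x = sym (+-identityˡ _)
eval-+ₚ (b ∷ p) []      x = sym (+-identityʳ _)
eval-+ₚ (b ∷ p) (c ∷ q) x = begin
  b + c + x * eval (p +ₚ q) x              ≡⟨ cong (λ e → b + c + x * e) (eval-+ₚ p q x) ⟩
  b + c + x * (eval p x + eval q x)        ≡⟨ regroup b c x (eval p x) (eval q x) ⟩
  (b + x * eval p x) + (c + x * eval q x)  ∎
  where
  regroup : ∀ b c x s t → b + c + x * (s + t) ≡ (b + x * s) + (c + x * t)
  regroup = solve-∀

eval--ₚ : ∀ p x → eval (-ₚ p) x ≡ - eval p x
eval--ₚ []      x = refl
eval--ₚ (b ∷ p) x = trans (cong (λ e → - b + x * e) (eval--ₚ p x)) (factor b x (eval p x))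
  where
  factor : ∀ b x s → - b + x * (- s) ≡ - (b + x * s)
  factor = solve-∀

eval-map-* : ∀ c p x → eval (map (c *_) p) x ≡ c * eval p x
eval-map-* c []      x = sym (*-zeroʳ c)
eval-map-* c (b ∷ p) x = trans (cong (λ e → c * b + x * e) (eval-map-* c p x)) (factor c b x (eval p x))
  where
  factor : ∀ c b x s → c * b + x * (c * s) ≡ c * (b + x * s)
  factor = solve-∀

-- Each coefficient of the left factor contributes a scaled copy of `q`, handled by `eval-map-*`;
-- prepending `0ℤ` to the remaining product multiplies its value by `x`.
eval-*ₚ : ∀ p q x → eval (p *ₚ q) x ≡ eval p x * eval q x
eval-*ₚ []      q x = refl
eval-*ₚ (b ∷ p) q x = begin
  eval (map (b *_) q +ₚ (0ℤ ∷ (p *ₚ q))) x            ≡⟨ eval-+ₚ (map (b *_) q) _ x ⟩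
  eval (map (b *_) q) x + (0ℤ + x * eval (p *ₚ q) x)  ≡⟨ cong₂ (λ s t → s + (0ℤ + x * t)) (eval-map-* b q x) (eval-*ₚ p q x) ⟩
  b * eval q x + (0ℤ + x * (eval p x * eval q x))     ≡⟨ factor b x (eval p x) (eval q x) ⟩
  (b + x * eval p x) * eval q x                       ∎
  where
  factor : ∀ b x s t → b * t + (0ℤ + x * (s * t)) ≡ (b + x * s) * t
  factor = solve-∀

eval-const : ∀ c x → eval (const c) x ≡ c
eval-const c x = trans (cong (λ e → c + e) (*-zeroʳ x)) (+-identityʳ c)

a-recurrence : ∀ n → a (suc (suc n)) ≡ a (suc n) - (+ suc n) ^ 2 * a n
a-recurrence n = begin
  eval (X *ₚ M (suc n) -ₚ k² *ₚ M n) 1ℤ             ≡⟨ eval-+ₚ (X *ₚ M (suc n)) _ 1ℤ ⟩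
  eval (X *ₚ M (suc n)) 1ℤ + eval (-ₚ (k² *ₚ M n)) 1ℤ
    ≡⟨ cong₂ _+_ (eval-*ₚ X (M (suc n)) 1ℤ) (trans (eval--ₚ (k² *ₚ M n) 1ℤ) (cong -_ (eval-*ₚ k² (M n) 1ℤ))) ⟩
  -- The leading `1ℤ` is `eval X 1ℤ`, which reduces by computation. The constant polynomial `k²`
  -- still has to be evaluated.
  1ℤ * a (suc n) - eval k² 1ℤ * a n                 ≡⟨ cong₂ (λ s t → s - t * a n) (*-identityˡ (a (suc n))) (eval-const ((+ suc n) ^ 2) 1ℤ) ⟩
  a (suc n) - (+ suc n) ^ 2 * a n                   ∎
  where
  k² : Poly
  k² = const ((+ suc n) ^ 2)

mainTheorem1 : ∀ (n : ℕ) → 2 ≤ n →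
    a n - a (n ∸ 1) + (+ (n ∸ 1)) ^ 2 * a (n ∸ 2) ≡ 0ℤ
-- Matching on the bound makes the truncated subtractions `∸ 1` and `∸ 2` compute to `suc n` and
-- `n`, the indices in `a-recurrence`.
mainTheorem1 (suc (suc n)) (s≤s (s≤s _)) = begin
  a (suc (suc n)) - a (suc n) + k² * a n        ≡⟨ cong (λ e → e - a (suc n) + k² * a n) (a-recurrence n) ⟩
  a (suc n) - k² * a n - a (suc n) + k² * a n   ≡⟨ cancel (a (suc n)) (k² * a n) ⟩
  0ℤ                                            ∎
  where
  k² : ℤ
  k² = (+ suc n) ^ 2
  cancel : ∀ s t → s - t - s + t ≡ 0ℤ
  cancel = solve-∀
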